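{- Let $a\in S$ with $a<100$. If $a\in R_i$ for some $i\le 150$, then there exists a directed path in $\Gamma_5$ from $2$ to $a$ all of whose vertices are at most $188^4$.
   Context: Define sets of positive integers $R_1,R_2,\dots$ recursively: $R_1=\{2\}$; for each $k\ge 1$, if $x\in R_k$ then $(x+5)^2\in R_{k+1}$; if $x^2\in R_k$ then $x\in R_{k+1}$. Let $S=\bigcup_i R_i$. The directed graph $\Gamma_5$ has vertex set $S$, up-edges $(n,(n+5)^2)$ for $n\in S$, and down-edges $(n^2,n)$ for $n\in S$. (Thus $x\in R_i$ exactly when there is a directed path with $i-1$ edges from $2$ to $x$.) -}

module Defs where

open import Data.Nat using (ℕ; zero; suc; _+_; _^_; _≤_)
open import Data.Product using (∃; _×_)

-- R k x : x ∈ R_k  (levels indexed from 1, as in the paper)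
data R : ℕ → ℕ → Set where
  base : R 1 2
  up   : ∀ {k x} → R k x → R (suc k) ((x + 5) ^ 2)
  down : ∀ {k x} → R k (x ^ 2) → R (suc k) x

S : ℕ → Set
S x = ∃ λ k → R k x

-- edges of Γ₅ (both endpoints in S)
data Edge : ℕ → ℕ → Set where
  upE   : ∀ {n} → S n → Edge n ((n + 5) ^ 2)
  downE : ∀ {n} → S n → Edge (n ^ 2) n

data Path : ℕ → ℕ → Set where
  [] : ∀ {x} → Path x x
  _∷_ : ∀ {x y z} → Edge x y → Path y z → Path x z

AllVerticesAtMost : ℕ → ∀ {x y} → Path x y → Set
AllVerticesAtMost B {x} [] = x ≤ B
AllVerticesAtMost B {x} (e ∷ p) = x ≤ B × AllVerticesAtMost B p

{-# OPTIONS --safe #-}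
-- An up-edge followed by a down-edge adds 5.  After an up-step to y ^ 2 with
-- y = m + 5, the next time the walk descends below this level it is at a square
-- z ^ 2 = y ^ 2 + 5 j, where the j additions of 5 have cost 2 j edges.  Since the
-- squares after y ^ 2 lie at distance at least 2 y + 1, a walk with few edges and
-- y > b is forced to have z = y.  Hence every excursion above b ^ 2 returns
-- exactly one up-down pair above its starting point, and it can be replaced by
-- that pair, which stays below b ^ 4 as long as y ≤ b ^ 2.
module Submission where

open import Defs
open import Data.Nat using (ℕ; zero; suc; _+_; _*_; _<_; _≤_; _^_; z≤n; s≤s; _≤?_)
open import Data.Nat.Properties
open import Data.Nat.Tactic.RingSolver using (solve-∀)
open import Data.Product using (Σ; _×_; _,_)
open import Relation.Binary.PropositionalEquality using (_≡_; refl; sym; cong; subst)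
open import Relation.Nullary using (yes; no; contradiction)
open import Relation.Nullary.Decidable using (from-yes)

suc-square : ∀ y → suc y ^ 2 ≡ suc (y ^ 2 + 2 * y)
suc-square = expanded
  where
  expanded : ∀ y → suc y * (suc y * 1) ≡ suc (y * (y * 1) + 2 * y)
  expanded = solve-∀

-- The square after `y ^ 2` is `y ^ 2 + 2 * y + 1`, which a surplus of at most `2 * y` cannot reach.
root-≤ : ∀ y z {d} → d ≤ 2 * y → z ^ 2 ≤ y ^ 2 + d → z ≤ y
root-≤ y z {d} d≤2y z²≤y²+d = ≮⇒≥ λ y<z → <-irrefl refl (begin-strict
  z ^ 2                <⟨ s≤s z²≤y²+d ⟩
  suc (y ^ 2 + d)      ≤⟨ s≤s (+-monoʳ-≤ (y ^ 2) d≤2y) ⟩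
  suc (y ^ 2 + 2 * y)  ≡⟨ suc-square y ⟨
  suc y ^ 2            ≤⟨ ^-monoˡ-≤ 2 y<z ⟩
  z ^ 2                ∎)
  where open ≤-Reasoning

^2-cancel-≤ : ∀ y z → y ^ 2 ≤ z ^ 2 → y ≤ z
^2-cancel-≤ y z y²≤z² = root-≤ z y z≤n (m≤n⇒m≤n+o 0 y²≤z²)

n≤n^2 : ∀ n → n ≤ n ^ 2
n≤n^2 zero    = z≤n
n≤n^2 (suc n) = m≤m*n (suc n) (suc n * 1)

BoundedPath : ℕ → ℕ → ℕ → Set
BoundedPath B x y = Σ (Path x y) (AllVerticesAtMost B)

_∷ʳ⟨_⟩_ : ∀ {B x y z} → BoundedPath B x y → z ≤ B → Edge y z → BoundedPath B x z
([]      , x≤B)       ∷ʳ⟨ z≤B ⟩ e = e ∷ [] , x≤B , z≤B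
((d ∷ p) , x≤B , p≤B) ∷ʳ⟨ z≤B ⟩ e with (p , p≤B) ∷ʳ⟨ z≤B ⟩ e
... | q , q≤B = d ∷ q , x≤B , q≤B

-- Membership in `S` travels with the path because appending an edge requires it; its level may
-- differ from that of the walk being shortened.
BoundedlyReachable : ℕ → ℕ → Set
BoundedlyReachable B x = S x × BoundedPath B 2 x

reach-up : ∀ {B x} → (x + 5) ^ 2 ≤ B → BoundedlyReachable B x → BoundedlyReachable B ((x + 5) ^ 2)
reach-up ≤B (s@(_ , r) , p) = (_ , up r) , p ∷ʳ⟨ ≤B ⟩ upE s

reach-down : ∀ {B x} → x ^ 2 ≤ B → BoundedlyReachable B (x ^ 2) → BoundedlyReachable B x
reach-down {x = x} x²≤B ((_ , r) , p) = s , p ∷ʳ⟨ ≤-trans (n≤n^2 x) x²≤B ⟩ downE s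
  where
  s : S x
  s = _ , down r

module _ {b K : ℕ} (2≤b² : 2 ≤ b ^ 2) (5K≤4b+5 : K * 5 ≤ 5 + 2 * (2 * b)) where

  b⁴ : ℕ
  b⁴ = b ^ 4

  square-≤b⁴ : ∀ {x} → x ≤ b ^ 2 → x ^ 2 ≤ b⁴
  square-≤b⁴ {x} x≤b² = subst (x ^ 2 ≤_) (^-*-assoc b 2 2) (^-monoˡ-≤ 2 x≤b²)

  b²≤b⁴ : b ^ 2 ≤ b⁴
  b²≤b⁴ = ≤-trans (n≤n^2 (b ^ 2)) (square-≤b⁴ ≤-refl)

  -- j counts the up-down pairs made on the current level, and l is the step at
  -- which the excursion left m.
  data Position (k x : ℕ) : Set where
    ground    : ∀ j → j * 2 < k → x ≤ b ^ 2 + j * 5 →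
                (x ≤ b ^ 2 → BoundedlyReachable b⁴ x) → Position k x
    excursion : ∀ {l m} j → Position l m → b < m + 5 →
                l + j * 2 < k → x ≡ (m + 5) ^ 2 + j * 5 → Position k x

  -- Restarts the count of pairs: a vertex already below `b ^ 2` needs no slack.
  ground₀ : ∀ {k x} → 0 < k → x ≤ b ^ 2 → BoundedlyReachable b⁴ x → Position k x
  ground₀ 0<k x≤b² reachable = ground 0 0<k (m≤n⇒m≤n+o 0 x≤b²) (λ _ → reachable)

  +5-≤ : ∀ {x} c j → x ≤ c + j * 5 → x + 5 ≤ c + suc j * 5
  +5-≤ {x} c j x≤c+5j = begin
    x + 5            ≤⟨ +-monoˡ-≤ 5 x≤c+5j ⟩
    c + j * 5 + 5    ≡⟨ +-assoc c (j * 5) 5 ⟩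
    c + (j * 5 + 5)  ≡⟨ cong (c +_) (+-comm (j * 5) 5) ⟩
    c + suc j * 5    ∎
    where open ≤-Reasoning

  -- Serves as the replacement for a whole excursion, so `k′` is left free: the original excursion
  -- may take more than two steps.
  up-down : ∀ {k k′ x} → Position k x → 2 + k ≤ k′ → Position k′ (x + 5)
  up-down {x = x} (ground j 2j<k x≤ reachable) 2+k≤k′ =
    ground (suc j) (≤-trans (s≤s (s≤s 2j<k)) 2+k≤k′) (+5-≤ (b ^ 2) j x≤)
      -- The detour through `(x + 5) ^ 2` is what forces the fourth power in the bound.
      λ x+5≤b² → let ≤b⁴ = square-≤b⁴ x+5≤b² in
        reach-down ≤b⁴ (reach-up ≤b⁴ (reachable (m+n≤o⇒m≤o x x+5≤b²)))
  up-down {k} {k′} (excursion {l} {m} j pos b<m+5 l+2j<k refl) 2+k≤k′ =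
    excursion (suc j) pos b<m+5 longer (solution ((m + 5) ^ 2) j)
    where
    solution : ∀ c j → c + j * 5 + 5 ≡ c + (5 + j * 5)
    solution = solve-∀
    shift : ∀ l n → l + (2 + n) ≡ 2 + (l + n)
    shift = solve-∀
    longer : l + suc j * 2 < k′
    longer = begin-strict
      l + suc j * 2    ≡⟨ shift l (j * 2) ⟩
      2 + (l + j * 2)  <⟨ s≤s (s≤s l+2j<k) ⟩
      2 + k            ≤⟨ 2+k≤k′ ⟩
      k′               ∎
      where open ≤-Reasoning

  -- Levels start at 1, so `j` pairs require `2 * j + 1 ≤ K`; the summand 5 in the hypothesis on `K`
  -- absorbs the extra 1.
  few-additions : ∀ {j k} → j * 2 < k → k ≤ K → j * 5 ≤ 2 * b
  few-additions {j} 2j<k k≤K = *-cancelˡ-≤ 2 (+-cancelˡ-≤ 5 _ _ (begin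
    5 + 2 * (j * 5)    ≡⟨ rearrange j ⟩
    suc (j * 2) * 5    ≤⟨ *-monoˡ-≤ 5 (≤-trans 2j<k k≤K) ⟩
    K * 5              ≤⟨ 5K≤4b+5 ⟩
    5 + 2 * (2 * b)    ∎))
    where
    open ≤-Reasoning
    rearrange : ∀ j → 5 + 2 * (j * 5) ≡ suc (j * 2) * 5
    rearrange = solve-∀

  position-up : ∀ {k x} → Position k x → Position (suc k) ((x + 5) ^ 2)
  position-up {k} {x} pos with x + 5 ≤? b | pos
  -- The entire current position is stored for the return, so excursions nest.
  ... | no  x+5≰b | _ =
    excursion 0 pos (≰⇒> x+5≰b) (s≤s (≤-reflexive (+-identityʳ k))) (sym (+-identityʳ _))
  ... | yes x+5≤b | ground j _ _ reachable =
    ground₀ (s≤s z≤n) square≤b² (reach-up (≤-trans square≤b² b²≤b⁴) (reachable x≤b²))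
    where
    square≤b² : (x + 5) ^ 2 ≤ b ^ 2
    square≤b² = ^-monoˡ-≤ 2 x+5≤b
    x≤b² : x ≤ b ^ 2
    x≤b² = ≤-trans (m+n≤o⇒m≤o x x+5≤b) (n≤n^2 b)
  ... | yes x+5≤b | excursion {m = m} j _ b<m+5 _ refl = contradiction (begin-strict
    b                         <⟨ b<m+5 ⟩
    m + 5                     ≤⟨ n≤n^2 (m + 5) ⟩
    (m + 5) ^ 2               ≤⟨ m≤m+n _ (j * 5) ⟩
    (m + 5) ^ 2 + j * 5       ≤⟨ m≤m+n _ 5 ⟩
    (m + 5) ^ 2 + j * 5 + 5   ≤⟨ x+5≤b ⟩
    b                         ∎) (<-irrefl refl)
    where open ≤-Reasoning

  position-down : ∀ {k z} → k ≤ K → Position k (z ^ 2) → Position (suc k) z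
  position-down {z = z} k≤K (ground j 2j<k z²≤ reachable) =
    ground₀ (s≤s z≤n) (≤-trans (n≤n^2 z) z²≤b²)
      (reach-down (≤-trans z²≤b² b²≤b⁴) (reachable z²≤b²))
    where
    z²≤b² : z ^ 2 ≤ b ^ 2
    -- The slack `j * 5` is too small to contain a square beyond `b ^ 2`.
    z²≤b² = ^-monoˡ-≤ 2 (root-≤ b z (few-additions {j} 2j<k k≤K) z²≤)
  position-down {k} {z} k≤K (excursion {l} {m} j pos b<m+5 l+2j<k z²≡) =
    -- The stored position at `m` resumes at `m + 5`. Since `l < k`, the return at step `suc k`
    -- comes at least two steps after departure.
    subst (Position (suc k)) (≤-antisym m+5≤z z≤m+5)
      (up-down pos (s≤s (≤-trans (s≤s (m≤m+n l (j * 2))) l+2j<k)))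
    where
    2j<k : j * 2 < k
    2j<k = ≤-trans (s≤s (m≤n+m (j * 2) l)) l+2j<k
    5j≤2[m+5] : j * 5 ≤ 2 * (m + 5)
    5j≤2[m+5] = ≤-trans (few-additions {j} 2j<k k≤K) (*-monoʳ-≤ 2 (<⇒≤ b<m+5))
    z≤m+5 : z ≤ m + 5
    z≤m+5 = root-≤ (m + 5) z 5j≤2[m+5] (≤-reflexive z²≡)
    m+5≤z : m + 5 ≤ z
    m+5≤z = ^2-cancel-≤ (m + 5) z (≤-trans (m≤m+n _ (j * 5)) (≤-reflexive (sym z²≡)))

  position : ∀ {k x} → k ≤ K → R k x → Position k x
  position _ base = ground₀ (s≤s z≤n) 2≤b² ((1 , base) , [] , ≤-trans 2≤b² b²≤b⁴)
  position 1+k≤K (up r)   = position-up (position (<⇒≤ 1+k≤K) r)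
  position 1+k≤K (down r) = position-down (<⇒≤ 1+k≤K) (position (<⇒≤ 1+k≤K) r)

  bounded-path : ∀ {k x} → k ≤ K → R k x → x ≤ b ^ 2 → BoundedPath b⁴ 2 x
  bounded-path k≤K r x≤b² with position k≤K r
  ... | ground _ _ _ reachable with reachable x≤b²
  ...   | _ , p = p
  -- An excursion stays at or above `(m + 5) ^ 2`, hence above `b ^ 2`.
  bounded-path k≤K r x≤b² | excursion {m = m} j _ b<m+5 _ refl =
    contradiction (^2-cancel-≤ (m + 5) b (m+n≤o⇒m≤o ((m + 5) ^ 2) x≤b²)) (<⇒≱ b<m+5)

theorem14 : ∀ (a : ℕ) → S a → a < 100 →
    ∀ (i : ℕ) → i ≤ 150 → R i a →
    Σ (Path 2 a) (λ p → AllVerticesAtMost (188 ^ 4) p)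
theorem14 a _ a<100 i i≤150 r =
  -- The step budget holds as 750 is at most 5 + 4 * 188 = 757.
  bounded-path {188} {150} (from-yes (2 ≤? 188 ^ 2)) (from-yes (150 * 5 ≤? 5 + 2 * (2 * 188)))
    i≤150 r (≤-trans (<⇒≤ a<100) (from-yes (100 ≤? 188 ^ 2)))
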